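{- Let $X$ be a second countable topological space (of any cardinality). Then $\mathcal{M}(X)=\mathcal{P}(X)$ if and only if the set of isolated points of $X$ is dense in $X$.
   Context: A point $x\in X$ is isolated if $\{x\}$ is open. For a topological space $X$, a subset $A\subseteq X$ is dense in an open set $U$ if $U\subseteq\overline{A}$, and codense in $U$ if $U\subseteq\overline{X\setminus A}$. A subset $A\subseteq X$ is monitorable if for every non-empty open set $U\subseteq X$ either $A$ is not dense in $U$ or $A$ is not codense in $U$. $\mathcal{M}(X)\subseteq\mathcal{P}(X)$ denotes the family of monitorable subsets of $X$, where $\mathcal{P}(X)$ is the powerset of $X$. -}

module Defs where

open import Data.Nat using (ℕ)
open import Data.Product using (Σ-syntax; ∃-syntax; _×_)
open import Data.Sum using (_⊎_)
open import Data.Unit.Polymorphic using (⊤)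
open import Level using (Level; suc; _⊔_; 0ℓ)
open import Relation.Nullary using (¬_)
open import Relation.Unary
  using (Pred; _∈_; _⊆_; _≐_; _∩_; ∁; ⋃; ｛_｝; U; Satisfiable)

-- Subsets are predicates at the level of the carrier, identified up to _≐_.
-- With excluded middle (assumed in the theorem) each predicate of any level is
-- ≐ to one of the form λ x → Lift c (T (f x)) with f : Carrier → Bool, so
-- Pred Carrier c is the full powerset, and every collection of subsets is, up
-- to _≐_, indexed by a type in Set c; open-⋃ thus covers arbitrary unions.
-- The empty set is open as the union over the empty index type.
record TopologicalSpace (c o : Level) : Set (suc (c ⊔ o)) where
  field
    Carrier : Set c
    Open    : Pred (Pred Carrier c) o
    open-≐  : ∀ {V W} → V ≐ W → Open V → Open W
    open-X  : Open (λ _ → ⊤)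
    open-∩  : ∀ {V W} → Open V → Open W → Open (V ∩ W)
    open-⋃  : ∀ {I : Set c} (F : I → Pred Carrier c) →
              (∀ i → Open (F i)) → Open (⋃ I F)

module _ {c o : Level} (X : TopologicalSpace c o) where
  open TopologicalSpace X

  -- A countable base is given by an enumeration, possibly with repetitions.
  -- Finite bases are covered, and so is the empty one (of the empty space),
  -- since adding ∅ to a base again gives a base.
  IsBase : (ℕ → Pred Carrier c) → Set (suc c ⊔ o)
  IsBase B = (∀ n → Open (B n)) ×
             (∀ V → Open V → ∀ x → x ∈ V → ∃[ n ] (x ∈ B n × B n ⊆ V))

  SecondCountable : Set (suc c ⊔ o)
  SecondCountable = Σ[ B ∈ (ℕ → Pred Carrier c) ] IsBase B

  Closed : Pred (Pred Carrier c) o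
  Closed C = Open (∁ C)

  closure : ∀ {a} → Pred Carrier a → Pred Carrier (suc c ⊔ o ⊔ a)
  closure A x = ∀ C → Closed C → A ⊆ C → x ∈ C

  DenseIn : ∀ {a v} → Pred Carrier a → Pred Carrier v → Set (suc c ⊔ o ⊔ a ⊔ v)
  DenseIn A V = V ⊆ closure A

  CodenseIn : ∀ {a v} → Pred Carrier a → Pred Carrier v → Set (suc c ⊔ o ⊔ a ⊔ v)
  CodenseIn A V = V ⊆ closure (∁ A)

  Isolated : Pred Carrier o
  Isolated x = Open ｛ x ｝

  𝓜 : Pred (Pred Carrier c) (suc c ⊔ o)
  𝓜 A = ∀ V → Open V → Satisfiable V → ¬ DenseIn A V ⊎ ¬ CodenseIn A V

  𝓟 : Pred (Pred Carrier c) 0ℓ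
  𝓟 = U

{-# OPTIONS --safe #-}
-- If x ∈ V is isolated, then {x} ⊆ V misses A or its complement, so A is not
-- both dense and codense in V. Conversely, let V ≠ ∅ be open without isolated
-- points. If V contains a minimal non-empty open set M, then M has two points,
-- and any point of M is dense and codense in M. If not, every non-empty open
-- subset of V is infinite (a finite one could be shrunk forever), so one can
-- greedily choose distinct points, two in each basic open subset of V; the set
-- of the first points of all these pairs is dense and codense in V.
module Submission where

open import Defs
open import Axiom.DoubleNegationElimination using (DoubleNegationElimination; em⇒dne)
open import Axiom.ExcludedMiddle using (ExcludedMiddle)
open import Data.Empty using (⊥-elim)
open import Data.List using (List; []; _∷_; length; filter)
open import Data.List.Membership.Propositional using () renaming (_∈_ to _∈ˡ_; _∉_ to _∉ˡ_)
open import Data.List.Membership.Propositional.Properties using (∈-filter⁺)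
open import Data.List.Properties using (filter-notAll)
open import Data.List.Relation.Unary.Any as Any using (here; there)
open import Data.Nat using (ℕ; zero; ⌊_/2⌋; _+_; _<_; s≤s⁻¹) renaming (suc to 1+)
open import Data.Nat.Properties
  using (<-≤-trans; ≤-refl; <-cmp; m<1+n⇒m<n∨m≡n; n≡⌊n+n/2⌋; +-suc)
open import Data.Product using (∃-syntax; Σ-syntax; _×_; _,_; proj₁; proj₂)
open import Data.Sum using (inj₁; inj₂)
open import Function using (_∘_)
open import Function.Bundles using (_⇔_; mk⇔)
open import Function.Definitions using (Injective)
open import Level using (Level; suc; _⊔_; Lift; lift; lower)
open import Relation.Binary.Definitions using (tri<; tri≈; tri>)
open import Relation.Binary.PropositionalEquality
  using (_≡_; _≢_; refl; sym; trans; cong; subst)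
open import Relation.Nullary using (¬_; Dec; yes; no; ¬?; contradiction)
open import Relation.Nullary.Decidable using (map′)
open import Relation.Unary using (Pred; _∈_; _∉_; _⊆_; _≐_; _∩_; ∁; ｛_｝; U; Satisfiable)

em-lower : ∀ {a} b → ExcludedMiddle (a ⊔ b) → ExcludedMiddle a
em-lower b em {P} = map′ lower lift (em {Lift b P})

-- Stated as "no finite list exhausts `P`", because a greedy choice only ever needs a point outside
-- the list of earlier ones.
Infinite : ∀ {a p} {A : Set a} → Pred A p → Set (a ⊔ p)
Infinite P = ∀ L → ∃[ x ] (x ∈ P × x ∉ˡ L)

module Transversal {a p} {A : Set a} (F : ℕ → Pred A p) (inf : ∀ n → Infinite (F n)) where

  history : ℕ → List A
  choice  : ℕ → A

  choice n = proj₁ (inf n (history n))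

  history zero   = []
  history (1+ n) = choice n ∷ history n

  choice∈ : ∀ n → choice n ∈ F n
  choice∈ n = proj₁ (proj₂ (inf n (history n)))

  choice∈history : ∀ {m n} → m < n → choice m ∈ˡ history n
  choice∈history {m} {1+ n} m<1+n with m<1+n⇒m<n∨m≡n m<1+n
  ... | inj₁ m<n  = there (choice∈history m<n)
  ... | inj₂ refl = here refl

  choice-fresh : ∀ {m n} → m < n → choice m ≢ choice n
  choice-fresh {m} {n} m<n eq =
    proj₂ (proj₂ (inf n (history n))) (subst (_∈ˡ history n) eq (choice∈history m<n))

  choice-injective : Injective _≡_ _≡_ choice
  choice-injective {m} {n} eq with <-cmp m n
  ... | tri< m<n _ _ = contradiction eq (choice-fresh m<n)
  ... | tri≈ _ m≡n _ = m≡n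
  ... | tri> _ _ n<m = contradiction (sym eq) (choice-fresh n<m)

⌊1+n+n/2⌋≡n : ∀ n → ⌊ 1+ (n + n) /2⌋ ≡ n
⌊1+n+n/2⌋≡n zero   = refl
⌊1+n+n/2⌋≡n (1+ n) = trans (cong (λ k → ⌊ 1+ (1+ k) /2⌋) (+-suc n n)) (cong 1+ (⌊1+n+n/2⌋≡n n))

-- Halving both sides forces `m` and `n` to agree, which leaves a number equal to its own successor.
m+m≢1+n+n : ∀ m n → m + m ≢ 1+ (n + n)
m+m≢1+n+n m n eq
  with refl ← trans (n≡⌊n+n/2⌋ m) (trans (cong ⌊_/2⌋ eq) (⌊1+n+n/2⌋≡n n))
  = n≢1+n eq
  where
  n≢1+n : ∀ {k} → k ≢ 1+ k
  n≢1+n ()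

module _ {c o : Level} (em : ExcludedMiddle (suc c ⊔ o)) (X : TopologicalSpace c o) where
  open TopologicalSpace X

  emᶜ : ExcludedMiddle c
  emᶜ = em-lower (suc c ⊔ o) em

  emᶜᵒ : ExcludedMiddle (c ⊔ o)
  emᶜᵒ = em-lower (suc c) em

  dneᶜ : DoubleNegationElimination c
  dneᶜ = em⇒dne emᶜ

  Meets : ∀ {a v} → Pred Carrier a → Pred Carrier v → Set (c ⊔ a ⊔ v)
  Meets A V = Satisfiable (V ∩ A)

  ∁-closed : ∀ {V} → Open V → Closed X (∁ V)
  ∁-closed = open-≐ ((λ v ¬v → ¬v v) , dneᶜ)

  -- Otherwise `∁ V` is a closed set that contains `A` and misses `x`. The double negation stays
  -- because `A` has an arbitrary level, at which excluded middle is not assumed.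
  closure⇒¬¬meets : ∀ {a} {A : Pred Carrier a} {V x} →
    Open V → x ∈ V → x ∈ closure X A → ¬ ¬ Meets A V
  closure⇒¬¬meets {V = V} V-open x∈V x∈Ā ¬meets =
    x∈Ā (∁ V) (∁-closed V-open) (λ y∈A y∈V → ¬meets (_ , y∈V , y∈A)) x∈V

  -- A point of `V` outside a closed `C` containing `A` would make `V ∩ ∁ C` a non-empty open subset
  -- of `V` that misses `A`.
  meets⇒dense : ∀ {a} {A : Pred Carrier a} {V} → Open V →
    (∀ W → Open W → Satisfiable W → W ⊆ V → Meets A W) → DenseIn X A V
  meets⇒dense {V = V} V-open meets x∈V C C-closed A⊆C = dneᶜ λ x∉C →
    let (y , (_ , y∉C) , y∈A) =
          meets (V ∩ ∁ C) (open-∩ V-open C-closed) (_ , x∈V , x∉C) proj₁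
    in y∉C (A⊆C y∈A)

  denseIsolated⇒monitorable : DenseIn X (Isolated X) U → ∀ A → 𝓜 X A
  denseIsolated⇒monitorable dense A V V-open (x , x∈V)
    with em⇒dne emᶜᵒ (closure⇒¬¬meets V-open x∈V (dense _))
  ... | z , z∈V , z-isolated with emᶜ {A z}
  ...   | yes z∈A = inj₂ λ codense →
          closure⇒¬¬meets z-isolated refl (codense z∈V) λ { (_ , refl , z∉A) → z∉A z∈A }
  ...   | no z∉A = inj₁ λ dense →
          closure⇒¬¬meets z-isolated refl (dense z∈V) λ { (_ , refl , z∈A) → z∉A z∈A }

  Minimal : Pred Carrier c → Set (suc c ⊔ o)
  Minimal M = Open M × Satisfiable M × (∀ W → Open W → Satisfiable W → W ⊆ M → M ⊆ W)

  -- For open `V` this is resolvability of the subspace `V` in the sense of Hewitt: it splits into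
  -- two disjoint dense subsets.
  Resolvable : Pred Carrier c → Set (suc c ⊔ o)
  Resolvable V = Σ[ A ∈ Pred Carrier c ] (DenseIn X A V × DenseIn X (∁ A) V)

  minimal⇒resolvable : ∀ {M} → Minimal M → (∀ {x} → x ∈ M → ¬ Isolated X x) → Resolvable M
  minimal⇒resolvable {M} (M-open , (x , x∈M) , min) ¬isolated =
    ｛ x ｝ ,
    meets⇒dense M-open (λ W W-open sat W⊆M → x , min W W-open sat W⊆M x∈M , refl) ,
    meets⇒dense M-open (λ W W-open sat W⊆M → dneᶜ λ ¬meets →
      -- If `W` had no point other than `x`, it would equal `｛ x ｝`, and `x` would be isolated.
      ¬isolated x∈M (open-≐
        ( (λ w → dneᶜ λ x≢ → ¬meets (_ , w , x≢))
        , λ { refl → min W W-open sat W⊆M x∈M })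
        W-open))

  ¬minimal⇒infinite : ∀ {V : Pred Carrier c} → (∀ M → M ⊆ V → ¬ Minimal M) →
    ∀ W → Open W → Satisfiable W → W ⊆ V → Infinite W
  ¬minimal⇒infinite {V} ¬min W W-open sat W⊆V L = dneᶜ λ ¬fresh →
    uncovered _ L ≤-refl W W-open sat W⊆V
      (λ y∈W → dneᶜ λ y∉L → ¬fresh (_ , y∈W , y∉L))
    where
    -- Induction on a bound for the length of `L`: as `W` is not minimal, some non-empty open
    -- `W′ ⊆ W` omits a point `x` of `W`, and `L` with `x` removed is a shorter list that still
    -- covers `W′`.
    uncovered : ∀ n L → length L < n → ∀ W → Open W → Satisfiable W → W ⊆ V → ¬ W ⊆ (_∈ˡ L)
    uncovered (1+ n) L |L|<1+n W W-open sat W⊆V W⊆L = ¬min W W⊆V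
      (W-open , sat , λ W′ W′-open sat′ W′⊆W {x} x∈W → dneᶜ λ x∉W′ →
        let ≢x? = λ y → ¬? (emᶜ {x ≡ y}) in
        uncovered n (filter ≢x? L)
          (<-≤-trans (filter-notAll ≢x? L (Any.map (λ x≡y x≢y → x≢y x≡y) (W⊆L x∈W)))
                     (s≤s⁻¹ |L|<1+n))
          W′ W′-open sat′ (W⊆V ∘ W′⊆W)
          (λ y∈W′ → ∈-filter⁺ ≢x? (W⊆L (W′⊆W y∈W′)) λ { refl → x∉W′ y∈W′ }))

  infinite⇒resolvable : SecondCountable X → ∀ {V} → Open V → Satisfiable V →
    (∀ W → Open W → Satisfiable W → W ⊆ V → Infinite W) → Resolvable V
  infinite⇒resolvable (B , B-open , B-base) {V} V-open V-sat inf =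
    Evens , meets⇒dense V-open meets-evens , meets⇒dense V-open meets-odds
    where
    -- The members of the base that are empty or not inside V are replaced by V.
    select : ∀ n → Dec (Satisfiable (B n) × B n ⊆ V) → Pred Carrier c
    select n (yes _) = B n
    select n (no  _) = V

    select-infinite : ∀ n d → Infinite (select n d)
    select-infinite n (yes (sat , B⊆V)) = inf (B n) (B-open n) sat B⊆V
    select-infinite n (no _)            = inf V V-open V-sat (λ v → v)

    select-⊆ : ∀ n d → Satisfiable (B n) → B n ⊆ V → select n d ⊆ B n
    select-⊆ n (yes _) _   _   = λ b → b
    select-⊆ n (no ¬p) sat B⊆V = ⊥-elim (¬p (sat , B⊆V))

    -- The indices `n + n` and `1+ (n + n)` both halve to `n`, so each selected set receives two
    -- distinct points.
    open Transversal (λ k → select ⌊ k /2⌋ emᶜ) (λ k → select-infinite ⌊ k /2⌋ emᶜ)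

    Evens : Pred Carrier c
    Evens x = ∃[ n ] choice (n + n) ≡ x

    -- A basic set around `x` inside `W` is non-empty and lies in `V`, so `select` keeps it and both
    -- of its chosen points fall in `W`.
    basic : ∀ W → Open W → Satisfiable W → W ⊆ V →
      ∃[ n ] (∀ k → n ≡ ⌊ k /2⌋ → choice k ∈ W)
    basic W W-open (x , x∈W) W⊆V with B-base W W-open x x∈W
    ... | n , x∈B , B⊆W =
      n , λ { k refl → B⊆W (select-⊆ _ emᶜ (x , x∈B) (W⊆V ∘ B⊆W) (choice∈ k)) }

    meets-evens : ∀ W → Open W → Satisfiable W → W ⊆ V → Meets Evens W
    meets-evens W W-open sat W⊆V =
      let (n , in-W) = basic W W-open sat W⊆V
      in choice (n + n) , in-W _ (n≡⌊n+n/2⌋ n) , n , refl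

    meets-odds : ∀ W → Open W → Satisfiable W → W ⊆ V → Meets (∁ Evens) W
    meets-odds W W-open sat W⊆V =
      let (n , in-W) = basic W W-open sat W⊆V
      in choice (1+ (n + n)) , in-W _ (sym (⌊1+n+n/2⌋≡n n)) ,
         -- Distinct indices give distinct points, so an odd-indexed point in `Evens` would equate
         -- an even index with an odd one.
         λ { (m , eq) → m+m≢1+n+n m n (choice-injective eq) }

  resolvable⇒¬monitorable : ∀ {V} → Open V → Satisfiable V → Resolvable V → ¬ (∀ A → 𝓜 X A)
  resolvable⇒¬monitorable V-open sat (A , dense , codense) mon with mon A _ V-open sat
  ... | inj₁ ¬dense   = ¬dense dense
  ... | inj₂ ¬codense = ¬codense codense

  -- If a closed `C` contains all isolated points but not `x`, then `∁ C` is a non-empty open set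
  -- without isolated points; either it or a minimal open set inside it is resolvable.
  monitorable⇒denseIsolated : SecondCountable X → (∀ A → 𝓜 X A) → DenseIn X (Isolated X) U
  monitorable⇒denseIsolated sc mon {x} _ C C-closed isolated⊆C = dneᶜ λ x∉C →
    case-minimal x∉C em
    where
    case-minimal : x ∉ C → ¬ Dec (∃[ M ] (M ⊆ ∁ C × Minimal M))
    case-minimal x∉C (yes (M , M⊆∁C , min@(M-open , sat , _))) =
      resolvable⇒¬monitorable M-open sat
        (minimal⇒resolvable min (λ y∈M → M⊆∁C y∈M ∘ isolated⊆C)) mon
    case-minimal x∉C (no ¬min) =
      resolvable⇒¬monitorable C-closed (x , x∉C)
        (infinite⇒resolvable sc C-closed (x , x∉C)
          (¬minimal⇒infinite λ M M⊆∁C min → ¬min (M , M⊆∁C , min))) mon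

proposition3p2 : ∀ {c o : Level} → ExcludedMiddle (suc c ⊔ o) →
    (X : TopologicalSpace c o) → SecondCountable X →
    (𝓜 X ≐ 𝓟 X) ⇔ DenseIn X (Isolated X) U
proposition3p2 em X sc = mk⇔ {A = 𝓜 X ≐ 𝓟 X} {B = DenseIn X (Isolated X) U}
  (λ (_ , all) → monitorable⇒denseIsolated em X sc (λ A → all {A} _))
  (λ dense → (λ _ → _) , λ {A} _ → denseIsolated⇒monitorable em X dense A)
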